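{- Let $H$ be a triangle-free finite simple graph with at least one edge and no isolated edges, and suppose $k_1' \geq k_0 + 2$ (with $k_0,k_1,k_1'$ as defined in the context). Then there is a constant $c$ (depending on $H$) such that for every integer $n \geq |H|$, \[ \operatorname{sat}(n,H) \geq \left( k_0 + \frac{k_1' + 1 - k_0}{k_1' + 2} \right) \frac{n}{2} - c. \] Further, if in addition $k_1 > k_0$, then \[ \operatorname{sat}(n,H) \geq \left( k_0 + \frac{k_1' + 1 - k_0}{k_1' + 1} \right) \frac{n}{2} - c. \]
   Context: Graphs are finite and simple; $|G|$ denotes the number of vertices. A graph $G$ is $H$-saturated if $G$ contains no subgraph isomorphic to $H$ but adding any edge joining two nonadjacent vertices of $G$ creates such a subgraph. $\operatorname{sat}(n,H)$ is the minimum number of edges of an $H$-saturated graph on $n$ vertices. For an edge $uv$ of $H$, let $N(uv) = (N(u)\setminus\{v\}) \cup (N(v)\setminus\{u\})$; the edge is isolated if $N(uv)=\varnothing$. Degrees are taken in $H$. Define $\mathrm{wt}_0(uv) = \max\{d(u),d(v)\} - 1$ and, for non-isolated $uv$, $\mathrm{wt}_1(uv) = \max_{w \in N(uv)} d(w)$. Let $k_0 = \min_{uv\in E(H)} \mathrm{wt}_0(uv)$, $k_1 = \min_{uv \in E(H)} \mathrm{wt}_1(uv)$, and $k_1' = \min\{\mathrm{wt}_1(uv) : uv \in E(H),\ \mathrm{wt}_0(uv) = k_0\}$. -}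

module Defs where

open import Data.Bool using (Bool; true; false; _∧_; _∨_; not; if_then_else_)
open import Data.Nat using (ℕ; zero; suc; _+_; _∸_; _⊔_; _≤_; _<ᵇ_)
open import Data.Fin using (Fin; toℕ; _≟_)
open import Data.List using (List; map; foldr; allFin; filterᵇ)
open import Data.Nat.ListAction using (sum)
open import Data.Product using (Σ; _×_; _,_; ∃; ∃-syntax)
open import Data.Sum using (_⊎_)
open import Data.Empty using (⊥)
open import Relation.Nullary using (¬_)
open import Relation.Nullary.Decidable using (⌊_⌋)
open import Relation.Binary.PropositionalEquality using (_≡_; _≢_)
open import Function.Definitions using (Injective)
open import Data.Integer using (ℤ; +_; _-_)
open import Data.Rational as ℚ using (ℚ; _/_)

record Graph (n : ℕ) : Set where
  field
    adj    : Fin n → Fin n → Bool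
    sym    : ∀ i j → adj i j ≡ adj j i
    irrefl : ∀ i → adj i i ≡ false
open Graph public

edges : ∀ {n} → Graph n → ℕ
edges {n} G = sum (map (λ i → sum (map (λ j →
  if (toℕ i <ᵇ toℕ j) ∧ adj G i j then 1 else 0) (allFin n))) (allFin n))

ContainsAdj : ∀ {n h} → (Fin n → Fin n → Bool) → Graph h → Set
ContainsAdj {n} {h} A H =
  Σ (Fin h → Fin n) λ f → Injective _≡_ _≡_ f ×
    (∀ i j → adj H i j ≡ true → A (f i) (f j) ≡ true)

Contains : ∀ {n h} → Graph n → Graph h → Set
Contains G H = ContainsAdj (adj G) H

_==_ : ∀ {n} → Fin n → Fin n → Bool
x == y = ⌊ x ≟ y ⌋

addEdge : ∀ {n} → Graph n → Fin n → Fin n → (Fin n → Fin n → Bool)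
addEdge G i j x y = adj G x y ∨ ((x == i) ∧ (y == j)) ∨ ((x == j) ∧ (y == i))

Saturated : ∀ {n h} → Graph n → Graph h → Set
Saturated {n} G H = ¬ Contains G H ×
  (∀ (i j : Fin n) → i ≢ j → adj G i j ≡ false → ContainsAdj (addEdge G i j) H)

module _ {h : ℕ} (H : Graph h) where
  deg : Fin h → ℕ
  deg u = sum (map (λ v → if adj H u v then 1 else 0) (allFin h))

  inN : Fin h → Fin h → Fin h → Bool
  inN u v w = (adj H u w ∧ not (w == v)) ∨ (adj H v w ∧ not (w == u))

  Isolated : Fin h → Fin h → Set
  Isolated u v = ∀ w → inN u v w ≡ false

  wt0 : Fin h → Fin h → ℕ
  wt0 u v = (deg u ⊔ deg v) ∸ 1

  -- max of d(w) over w ∈ N(uv) (used only for non-isolated edges)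
  wt1 : Fin h → Fin h → ℕ
  wt1 u v = foldr _⊔_ 0 (map deg (filterᵇ (inN u v) (allFin h)))

  TriangleFree : Set
  TriangleFree = ∀ a b c → adj H a b ≡ true → adj H b c ≡ true → adj H a c ≡ true → ⊥

  HasEdge : Set
  HasEdge = ∃[ u ] ∃[ v ] adj H u v ≡ true

  NoIsolatedEdge : Set
  NoIsolatedEdge = ∀ u v → adj H u v ≡ true → ¬ Isolated u v

  IsK0 : ℕ → Set
  IsK0 k = (∃[ u ] ∃[ v ] (adj H u v ≡ true × wt0 u v ≡ k)) ×
           (∀ u v → adj H u v ≡ true → k ≤ wt0 u v)

  IsK1 : ℕ → Set
  IsK1 k = (∃[ u ] ∃[ v ] (adj H u v ≡ true × wt1 u v ≡ k)) ×
           (∀ u v → adj H u v ≡ true → k ≤ wt1 u v)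

  IsK1' : ℕ → ℕ → Set
  IsK1' k0 k = (∃[ u ] ∃[ v ] (adj H u v ≡ true × wt0 u v ≡ k0 × wt1 u v ≡ k)) ×
               (∀ u v → adj H u v ≡ true → wt0 u v ≡ k0 → k ≤ wt1 u v)

bound2 : ℕ → ℕ → ℕ → ℚ → ℚ
bound2 k0 k1' n c =
  ((+ k0 / 1) ℚ.+ ((+ (k1' + 1) - + k0) / suc (suc k1'))) ℚ.* (+ n / 2) ℚ.- c

bound1 : ℕ → ℕ → ℕ → ℚ → ℚ
bound1 k0 k1' n c =
  ((+ k0 / 1) ℚ.+ ((+ (k1' + 1) - + k0) / suc k1')) ℚ.* (+ n / 2) ℚ.- c

{-# OPTIONS --safe #-}
module Submission where

-- Call a vertex of G low if its degree is at most k0, big if it is at least k1', huge if it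
-- exceeds k1'. Adding an edge between non-adjacent low vertices x, y creates a copy of H in
-- which xy plays an edge uv with wt₀(uv) = k0, so some w ∈ N(uv) has degree ≥ k1' in H. If the
-- image of w has degree exactly k1', all its edges in G are used by the copy; as H is
-- triangle-free, that image cannot be adjacent to both x and y. Hence, up to boundedly many
-- exceptions (unions of cliques of low vertices), every low vertex has a big neighbour, and low
-- vertices without huge neighbours are determined by their sets of big neighbours. In
-- particular a vertex of degree exactly k1' is the only big neighbour of at most one of them.
--
-- Discharging: with r = (k1' + 1 - k0) / K the claimed excess over k0, a huge vertex sends r to
-- each low neighbour; a vertex of degree k1' sends r to a low neighbour having no other big
-- neighbour and r/2 to the others. If k1 > k0, at most one vertex of degree > k0 has only low
-- neighbours, which saves one payment per vertex and allows K = k1' + 1 in place of k1' + 2.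

open import Defs
open import Data.Bool using (Bool; true; false; _∧_; _∨_; not; if_then_else_; T; T?)
import Data.Bool.Properties as Bool
open import Data.Nat using (ℕ; zero; suc; _+_; _*_; _∸_; _⊔_; _≤_; _<_; _≤?_; _<?_; _<ᵇ_; z≤n; s≤s)
open import Data.Nat.Properties hiding (_≟_)
open import Data.Nat.Tactic.RingSolver using (solve-∀)
import Data.Nat.ListAction as List using (sum)
open import Data.Fin using (Fin; zero; suc; toℕ; _≟_)
open import Data.Fin.Properties using (any?; all?; toℕ-injective)
open import Data.List using (List; _∷_; map; foldr; allFin; tabulate; filterᵇ)
open import Data.List.Properties using (map-tabulate)
open import Data.List.Membership.Propositional using (_∈_)
open import Data.List.Membership.Propositional.Properties using (∈-filter⁻)
open import Data.List.Relation.Unary.Any using (here; there)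
open import Data.Product using (Σ; ∃-syntax; _×_; _,_; proj₁; proj₂)
open import Data.Sum as Sum using (_⊎_; inj₁; inj₂; [_,_]; swap; map₂)
open import Data.Empty using (⊥; ⊥-elim)
open import Function using (_∘_; id; case_of_)
open import Function.Definitions using (Injective)
open import Level using (0ℓ)
open import Relation.Nullary using (¬_; Dec; yes; no; does; contradiction)
open import Relation.Nullary.Decidable using (_×-dec_; _⊎-dec_; _→-dec_; ¬?; decidable-stable)
open import Relation.Binary.Definitions using (tri<; tri≈; tri>)
open import Function.Bundles using (Equivalence)
open import Relation.Unary using (Pred; Decidable)
open import Relation.Binary.PropositionalEquality as ≡ using (_≡_; _≢_; refl; cong; cong₂; subst; trans)
open import Algebra.Properties.CommutativeMonoid.Sum +-0-commutativeMonoid using (sum-cong-≗; ∑-distrib-+; ∑-comm) renaming (sum to ∑)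
open import Algebra.Properties.Semiring.Sum +-*-semiring using (*-distribˡ-sum; *-distribʳ-sum)
open import Data.Integer using (ℤ; +_)
import Data.Integer as ℤ
import Data.Integer.Properties as ℤ
import Data.Integer.Tactic.RingSolver as ℤ
open import Data.Rational using (ℚ; _/_)
import Data.Rational as ℚ
import Data.Rational.Properties as ℚ
open import Data.Rational.Unnormalised as ℚᵘ using (mkℚᵘ)
import Data.Rational.Unnormalised.Properties as ℚᵘ

private
  variable
    m n h : ℕ
    A B C D : Set

-- Sums and counting over Fin n

∑-mono : {f g : Fin n → ℕ} → (∀ i → f i ≤ g i) → ∑ f ≤ ∑ g
∑-mono {zero}  f≤g = z≤n
∑-mono {suc n} f≤g = +-mono-≤ (f≤g zero) (∑-mono (f≤g ∘ suc))

∑-const : ∀ n c → ∑ {n} (λ _ → c) ≡ n * c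
∑-const zero    c = refl
∑-const (suc n) c = cong (_+_ c) (∑-const n c)

∑-zero : {f : Fin n → ℕ} → (∀ i → f i ≡ 0) → ∑ f ≡ 0
∑-zero {n} f≡0 = trans (sum-cong-≗ f≡0) (trans (∑-const n 0) (*-zeroʳ n))

term≤∑ : (f : Fin n → ℕ) (i : Fin n) → f i ≤ ∑ f
term≤∑ f zero    = m≤m+n _ _
term≤∑ f (suc i) = ≤-trans (term≤∑ (f ∘ suc) i) (m≤n+m _ _)

sum-map-allFin : (f : Fin n → ℕ) → List.sum (map f (allFin n)) ≡ ∑ f
sum-map-allFin f = trans (cong List.sum (map-tabulate id f)) (sum-tabulate f)
  where
  sum-tabulate : (g : Fin m → ℕ) → List.sum (tabulate g) ≡ ∑ g
  sum-tabulate {zero}  g = refl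
  sum-tabulate {suc m} g = cong (_+_ (g zero)) (sum-tabulate (g ∘ suc))

⟦_⟧ : Dec A → ℕ
⟦ d ⟧ = if does d then 1 else 0

⟦⟧-true : (d : Dec A) → A → ⟦ d ⟧ ≡ 1
⟦⟧-true (yes _) _ = refl
⟦⟧-true (no ¬a) a = contradiction a ¬a

⟦⟧-false : (d : Dec A) → ¬ A → ⟦ d ⟧ ≡ 0
⟦⟧-false (yes a) ¬a = contradiction a ¬a
⟦⟧-false (no _)  _  = refl

⟦⟧-mono : (d : Dec A) (e : Dec B) → (A → B) → ⟦ d ⟧ ≤ ⟦ e ⟧
⟦⟧-mono (yes a) e f = ≤-reflexive (≡.sym (⟦⟧-true e (f a)))
⟦⟧-mono (no _)  e f = z≤n

module _ {P : Pred (Fin n) 0ℓ} where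

  count : Decidable P → ℕ
  count P? = ∑ (λ i → ⟦ P? i ⟧)

  count-none : (P? : Decidable P) → (∀ i → ¬ P i) → count P? ≡ 0
  count-none P? ¬P = ∑-zero (λ i → ⟦⟧-false (P? i) (¬P i))

count-mono : {P Q : Pred (Fin n) 0ℓ} (P? : Decidable P) (Q? : Decidable Q) →
             (∀ i → P i → Q i) → count P? ≤ count Q?
count-mono P? Q? P⊆Q = ∑-mono (λ i → ⟦⟧-mono (P? i) (Q? i) (P⊆Q i))

count-cover : {P Q R : Pred (Fin n) 0ℓ} (P? : Decidable P) (Q? : Decidable Q) (R? : Decidable R) →
              (∀ i → P i → Q i ⊎ R i) → count P? ≤ count Q? + count R?
count-cover P? Q? R? P⊆Q∪R =
  ≤-trans (∑-mono pointwise) (≤-reflexive (∑-distrib-+ (λ i → ⟦ Q? i ⟧) (λ i → ⟦ R? i ⟧)))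
  where
  pointwise : ∀ i → ⟦ P? i ⟧ ≤ ⟦ Q? i ⟧ + ⟦ R? i ⟧
  pointwise i with P? i
  ... | no _ = z≤n
  ... | yes p with P⊆Q∪R i p
  ...   | inj₁ q = ≤-trans (≤-reflexive (≡.sym (⟦⟧-true (Q? i) q))) (m≤m+n _ _)
  ...   | inj₂ r = ≤-trans (≤-reflexive (≡.sym (⟦⟧-true (R? i) r))) (m≤n+m _ _)

count-disjoint : {P Q R : Pred (Fin n) 0ℓ} (P? : Decidable P) (Q? : Decidable Q) (R? : Decidable R) →
                 (∀ i → P i → R i) → (∀ i → Q i → R i) → (∀ i → P i → ¬ Q i) →
                 count P? + count Q? ≤ count R?
count-disjoint P? Q? R? P⊆R Q⊆R P∩Q=∅ =
  ≤-trans (≤-reflexive (≡.sym (∑-distrib-+ (λ i → ⟦ P? i ⟧) (λ i → ⟦ Q? i ⟧)))) (∑-mono pointwise)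
  where
  pointwise : ∀ i → ⟦ P? i ⟧ + ⟦ Q? i ⟧ ≤ ⟦ R? i ⟧
  pointwise i with P? i
  ... | no _  = ⟦⟧-mono (Q? i) (R? i) (Q⊆R i)
  ... | yes p = ≤-reflexive (trans (cong suc (⟦⟧-false (Q? i) (P∩Q=∅ i p))) (≡.sym (⟦⟧-true (R? i) (P⊆R i p))))

count-≟ : (i : Fin n) → count (_≟ i) ≡ 1
count-≟ {suc n} zero    = cong suc (∑-zero {n} (λ _ → refl))
count-≟ {suc n} (suc i) = count-≟ i

count-subsingleton : {P : Pred (Fin n) 0ℓ} (P? : Decidable P) →
                     (∀ i j → P i → P j → i ≡ j) → count P? ≤ 1
count-subsingleton P? unique with any? P?
... | no ∄P        = ≤-trans (≤-reflexive (count-none P? (λ i p → ∄P (i , p)))) z≤n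
... | yes (i , Pi) = ≤-trans (count-mono P? (_≟ i) (λ j Pj → unique j i Pj Pi)) (≤-reflexive (count-≟ i))

count<2⇒unique : {P : Pred (Fin n) 0ℓ} (P? : Decidable P) → count P? ≤ 1 → ∀ {i j} → P i → P j → i ≡ j
count<2⇒unique {P = P} P? ≤1 {i} {j} Pi Pj = decidable-stable (i ≟ j) λ i≢j →
  <⇒≱ (≤-trans (≤-reflexive (≡.sym (cong₂ _+_ (count-≟ i) (count-≟ j))))
               (count-disjoint (_≟ i) (_≟ j) P? (λ { _ refl → Pi }) (λ { _ refl → Pj })
                  (λ { _ refl i≡j → i≢j i≡j }))) ≤1

-- Double counting of the pairs `(i , f i)` with `P i`: a fibre has at most one element by
-- injectivity, and none outside `Q`.
count-injection : {P : Pred (Fin m) 0ℓ} {Q : Pred (Fin n) 0ℓ} (P? : Decidable P) (Q? : Decidable Q)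
                  (f : Fin m → Fin n) → Injective _≡_ _≡_ f → (∀ i → P i → Q (f i)) → count P? ≤ count Q?
count-injection P? Q? f f-inj P⇒Q = begin
  ∑ (λ i → ⟦ P? i ⟧)                                ≤⟨ ∑-mono (λ i → ≤-trans (⟦⟧-mono (P? i) (P? i ×-dec f i ≟ f i) (_, refl)) (term≤∑ (λ z → ⟦ P? i ×-dec f i ≟ z ⟧) (f i))) ⟩
  ∑ (λ i → ∑ (λ z → ⟦ P? i ×-dec f i ≟ z ⟧))       ≡⟨ ∑-comm (λ i z → ⟦ P? i ×-dec f i ≟ z ⟧) ⟩
  ∑ (λ z → count (λ i → P? i ×-dec f i ≟ z))        ≤⟨ ∑-mono fibre ⟩
  ∑ (λ z → ⟦ Q? z ⟧)                                ∎
  where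
  open ≤-Reasoning
  fibre : ∀ z → count (λ i → P? i ×-dec f i ≟ z) ≤ ⟦ Q? z ⟧
  fibre z with Q? z
  ... | yes _ = count-subsingleton (λ i → P? i ×-dec f i ≟ z) (λ { i j (_ , fi≡z) (_ , fj≡z) → f-inj (trans fi≡z (≡.sym fj≡z)) })
  ... | no ¬Q = ≤-reflexive (count-none (λ i → P? i ×-dec f i ≟ z) (λ { i (Pi , refl) → ¬Q (P⇒Q i Pi) }))

-- Pigeonhole: if `z` were missed, `f` would inject `P` into `Q` without `z`, which is smaller than
-- `P`.
count-surjection : {P : Pred (Fin m) 0ℓ} {Q : Pred (Fin n) 0ℓ} (P? : Decidable P) (Q? : Decidable Q)
                   (f : Fin m → Fin n) → Injective _≡_ _≡_ f → (∀ i → P i → Q (f i)) →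
                   count Q? ≤ count P? → ∀ {z} → Q z → ∃[ i ] P i × f i ≡ z
count-surjection P? Q? f f-inj P⇒Q Q≤P {z} Qz =
  decidable-stable (any? (λ i → P? i ×-dec f i ≟ z)) λ missed →
    let Q∖z? = λ y → Q? y ×-dec ¬? (y ≟ z) in
    <⇒≱ (begin-strict
      count P?                     ≤⟨ count-injection P? Q∖z? f f-inj (λ i Pi → P⇒Q i Pi , λ fi≡z → missed (i , Pi , fi≡z)) ⟩
      count Q∖z?                   <⟨ n<1+n _ ⟩
      1 + count Q∖z?               ≡⟨ cong (_+ count Q∖z?) (count-≟ z) ⟨
      count (_≟ z) + count Q∖z?    ≤⟨ count-disjoint (_≟ z) Q∖z? Q? (λ { _ refl → Qz }) (λ _ → proj₁) (λ { _ refl (_ , z≢z) → z≢z refl }) ⟩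
      count Q?                     ∎) Q≤P
  where open ≤-Reasoning

-- Graphs

Adj : Graph n → Fin n → Fin n → Set
Adj G x y = adj G x y ≡ true

adj? : (G : Graph n) (x y : Fin n) → Dec (Adj G x y)
adj? G x y = adj G x y Bool.≟ true

Adj-sym : (G : Graph n) {x y : Fin n} → Adj G x y → Adj G y x
Adj-sym G {x} {y} = trans (sym G y x)

Adj⇒≢ : (G : Graph n) {x y : Fin n} → Adj G x y → x ≢ y
Adj⇒≢ G {x} xy refl = case trans (≡.sym xy) (irrefl G x) of λ ()

deg≡count : (G : Graph n) (x : Fin n) → deg G x ≡ count (adj? G x)
deg≡count G x = trans (sum-map-allFin (λ y → if adj G x y then 1 else 0)) (sum-cong-≗ (λ y → indicator (adj G x y)))
  where
  indicator : ∀ b → (if b then 1 else 0) ≡ ⟦ b Bool.≟ true ⟧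
  indicator true  = refl
  indicator false = refl

∑deg≤2edges : (G : Graph n) → ∑ (deg G) ≤ 2 * edges G
∑deg≤2edges {n} G = begin
  ∑ (deg G)                                          ≡⟨ sum-cong-≗ (λ i → sum-map-allFin (λ j → 𝟙 (adj G i j))) ⟩
  ∑ (λ i → ∑ (λ j → 𝟙 (adj G i j)))                 ≤⟨ ∑-mono (λ i → ∑-mono (λ j → split i j)) ⟩
  ∑ (λ i → ∑ (λ j → up i j + up j i))               ≡⟨ sum-cong-≗ (λ i → ∑-distrib-+ (up i) (λ j → up j i)) ⟩
  ∑ (λ i → ∑ (up i) + ∑ (λ j → up j i))             ≡⟨ ∑-distrib-+ (λ i → ∑ (up i)) (λ i → ∑ (λ j → up j i)) ⟩
  ∑ (λ i → ∑ (up i)) + ∑ (λ i → ∑ (λ j → up j i))   ≡⟨ cong (_+_ (∑ (λ i → ∑ (up i)))) (∑-comm (λ i j → up j i)) ⟩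
  ∑ (λ i → ∑ (up i)) + ∑ (λ i → ∑ (up i))           ≡⟨ cong₂ _+_ edges≡ edges≡ ⟨
  edges G + edges G                                  ≡⟨ cong (_+_ (edges G)) (+-identityʳ (edges G)) ⟨
  2 * edges G                                        ∎
  where
  open ≤-Reasoning
  𝟙 : Bool → ℕ
  𝟙 b = if b then 1 else 0
  up : Fin n → Fin n → ℕ
  up i j = 𝟙 ((toℕ i <ᵇ toℕ j) ∧ adj G i j)
  edges≡ : edges G ≡ ∑ (λ i → ∑ (up i))
  edges≡ = trans (sum-map-allFin (λ i → List.sum (map (up i) (allFin n)))) (sum-cong-≗ (λ i → sum-map-allFin (up i)))
  T⇒≡ : ∀ {b} → T b → b ≡ true
  T⇒≡ {true} _ = refl
  split : ∀ i j → 𝟙 (adj G i j) ≤ up i j + up j i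
  split i j with adj G i j in ij
  ... | false = z≤n
  ... | true with <-cmp (toℕ i) (toℕ j)
  ...   | tri< i<j _ _ rewrite T⇒≡ (<⇒<ᵇ i<j) = m≤m+n _ _
  ...   | tri≈ _ i≡j _ = contradiction (toℕ-injective i≡j) (Adj⇒≢ G ij)
  ...   | tri> _ _ j<i rewrite T⇒≡ (<⇒<ᵇ j<i) | Adj-sym G ij = m≤n+m _ _

Adj⇒0<deg : (G : Graph n) {x y : Fin n} → Adj G x y → 0 < deg G x
Adj⇒0<deg G {x} {y} xy = begin
  1                    ≡⟨ ⟦⟧-true (adj? G x y) xy ⟨
  ⟦ adj? G x y ⟧       ≤⟨ term≤∑ (λ z → ⟦ adj? G x z ⟧) y ⟩
  count (adj? G x)     ≡⟨ deg≡count G x ⟨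
  deg G x              ∎
  where open ≤-Reasoning

-- A clique lies in the closed neighbourhood of any one of its members.
clique-size : (G : Graph n) {P : Pred (Fin n) 0ℓ} (P? : Decidable P) (d : ℕ) →
              (∀ x → P x → deg G x ≤ d) → (∀ x y → P x → P y → x ≢ y → Adj G x y) →
              count P? ≤ suc d
clique-size G P? d deg≤d clique with any? P?
... | no ∄P        = ≤-trans (≤-reflexive (count-none P? (λ i p → ∄P (i , p)))) z≤n
... | yes (x , Px) = begin
  count P?                           ≤⟨ count-cover P? (_≟ x) (adj? G x) x-or-neighbour ⟩
  count (_≟ x) + count (adj? G x)    ≡⟨ cong₂ _+_ (count-≟ x) (≡.sym (deg≡count G x)) ⟩
  suc (deg G x)                      ≤⟨ s≤s (deg≤d x Px) ⟩
  suc d                              ∎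
  where
  open ≤-Reasoning
  x-or-neighbour : ∀ y → _ → y ≡ x ⊎ Adj G x y
  x-or-neighbour y Py with y ≟ x
  ... | yes y≡x = inj₁ y≡x
  ... | no  y≢x = inj₂ (clique x y Px Py (y≢x ∘ ≡.sym))

-- Boolean reflection and heavy neighbours of an edge

==⇒≡ : {x y : Fin n} → (x == y) ≡ true → x ≡ y
==⇒≡ {x = x} {y} eq with x ≟ y
... | yes x≡y = x≡y

not-==⇒≢ : {x y : Fin n} → not (x == y) ≡ true → x ≢ y
not-==⇒≢ {x = x} {y} eq with x ≟ y
... | no x≢y = x≢y

∧⁻ : ∀ {a b} → a ∧ b ≡ true → a ≡ true × b ≡ true
∧⁻ {true} {true} _ = refl , refl

∨⁻ : ∀ {a b} → a ∨ b ≡ true → a ≡ true ⊎ b ≡ true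
∨⁻ {true}  _ = inj₁ refl
∨⁻ {false} b = inj₂ b

-- The bound is a successor because the fold of the empty list is 0; only a positive maximum is sure
-- to be attained.
foldr-⊔-witness : (f : A → ℕ) {k : ℕ} (xs : List A) → suc k ≤ foldr _⊔_ 0 (map f xs) →
                  ∃[ x ] x ∈ xs × suc k ≤ f x
foldr-⊔-witness f (x ∷ xs) k< with ⊔-sel (f x) (foldr _⊔_ 0 (map f xs))
... | inj₁ eq = x , here refl , subst (_ ≤_) eq k<
... | inj₂ eq with foldr-⊔-witness f xs (subst (_ ≤_) eq k<)
...   | y , y∈xs , k<fy = y , there y∈xs , k<fy

-- An element of N(uv) of large degree. It differs from both ends, so every edge at `w` survives
-- when the edge `uv` is removed.
record HeavyNeighbour (H : Graph h) (u v : Fin h) (k : ℕ) : Set where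
  constructor heavy
  field
    {w}    : Fin h
    w≢u    : w ≢ u
    w≢v    : w ≢ v
    beside : Adj H u w ⊎ Adj H v w
    k≤deg  : k ≤ deg H w

heavyNeighbour : (H : Graph h) (u v : Fin h) {k : ℕ} → 0 < k → k ≤ wt1 H u v → HeavyNeighbour H u v k
heavyNeighbour {h} H u v {suc k} _ k< with foldr-⊔-witness (deg H) (filterᵇ (inN H u v) (allFin h)) k<
... | w , w∈ , k<w with ∨⁻ (Equivalence.to Bool.T-≡ (proj₂ (∈-filter⁻ (T? ∘ inN H u v) {xs = allFin h} w∈)))
...   | inj₁ p with uw , w≢v ← ∧⁻ p = heavy (Adj⇒≢ H (Adj-sym H uw)) (not-==⇒≢ w≢v) (inj₁ uw) k<w
...   | inj₂ p with vw , w≢u ← ∧⁻ p = heavy (not-==⇒≢ w≢u) (Adj⇒≢ H (Adj-sym H vw)) (inj₂ vw) k<w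

-- Copies of H in G + xy

-- A copy of H in G + xy that really uses the new edge, oriented so that `u` goes to `x` and `v` to
-- `y`; no other edge of H can be missing from G.
record NearCopy (G : Graph n) (H : Graph h) (x y : Fin n) : Set where
  field
    f         : Fin h → Fin n
    f-inj     : Injective _≡_ _≡_ f
    u v       : Fin h
    fu≡x      : f u ≡ x
    fv≡y      : f v ≡ y
    uv        : Adj H u v
    preserves : ∀ i j → Adj H i j → Adj G (f i) (f j) ⊎ (i ≡ u × j ≡ v) ⊎ (i ≡ v × j ≡ u)

flip : {G : Graph n} {H : Graph h} {x y : Fin n} → NearCopy G H x y → NearCopy G H y x
flip {H = H} c = record
  { f = f ; f-inj = f-inj ; u = v ; v = u ; fu≡x = fv≡y ; fv≡y = fu≡x ; uv = Adj-sym H uv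
  ; preserves = λ i j ij → map₂ swap (preserves i j ij) }
  where open NearCopy c

-- If no edge of H were mapped onto the added edge, the copy would already lie in G.
nearCopy : {G : Graph n} {H : Graph h} → Saturated G H → {x y : Fin n} → x ≢ y → ¬ Adj G x y → NearCopy G H x y
nearCopy {n} {h} {G} {H} (H⊄G , saturated) {x} {y} x≢y ¬xy
  with saturated x y x≢y (Bool.¬-not ¬xy)
... | f , f-inj , hom = fromWitness (any? λ i → any? λ j → adj? H i j ×-dec (f i ≟ x) ×-dec (f j ≟ y))
  where
  image : ∀ i j → Adj H i j → Adj G (f i) (f j) ⊎ (f i ≡ x × f j ≡ y) ⊎ (f i ≡ y × f j ≡ x)
  image i j ij with ∨⁻ (hom i j ij)
  ... | inj₁ e = inj₁ e
  ... | inj₂ e with ∨⁻ e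
  ...   | inj₁ p = inj₂ (inj₁ (==⇒≡ (proj₁ (∧⁻ p)) , ==⇒≡ (proj₂ (∧⁻ p))))
  ...   | inj₂ p = inj₂ (inj₂ (==⇒≡ (proj₁ (∧⁻ p)) , ==⇒≡ (proj₂ (∧⁻ p))))
  fromWitness : Dec (∃[ i ] ∃[ j ] Adj H i j × f i ≡ x × f j ≡ y) → NearCopy G H x y
  fromWitness (no unused) = ⊥-elim (H⊄G (f , f-inj , hom′))
    where
    hom′ : ∀ i j → Adj H i j → Adj G (f i) (f j)
    hom′ i j ij with image i j ij
    ... | inj₁ e                 = e
    ... | inj₂ (inj₁ (fi , fj))  = contradiction (i , j , ij , fi , fj) unused
    ... | inj₂ (inj₂ (fi , fj))  = contradiction (j , i , Adj-sym H ij , fj , fi) unused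
  fromWitness (yes (u , v , uv , fu , fv)) = record
    { f = f ; f-inj = f-inj ; u = u ; v = v ; fu≡x = fu ; fv≡y = fv ; uv = uv
    ; preserves = λ i j ij → map₂ (Sum.map
        (λ { (fi , fj) → f-inj (trans fi (≡.sym fu)) , f-inj (trans fj (≡.sym fv)) })
        (λ { (fi , fj) → f-inj (trans fi (≡.sym fv)) , f-inj (trans fj (≡.sym fu)) })) (image i j ij) }

module NearCopyDegrees {G : Graph n} {H : Graph h} {x y : Fin n} (c : NearCopy G H x y) where
  open NearCopy c

  off-preserves : ∀ {w} → w ≢ u → w ≢ v → ∀ i → Adj H w i → Adj G (f w) (f i)
  off-preserves {w} w≢u w≢v i wi with preserves w i wi
  ... | inj₁ e                = e
  ... | inj₂ (inj₁ (w≡u , _)) = contradiction w≡u w≢u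
  ... | inj₂ (inj₂ (w≡v , _)) = contradiction w≡v w≢v

  off-preserves′ : ∀ {w} → w ≢ u → w ≢ v → ∀ {i} → Adj H i w → Adj G (f i) (f w)
  off-preserves′ w≢u w≢v iw = Adj-sym G (off-preserves w≢u w≢v _ (Adj-sym H iw))

  deg-off≤ : ∀ {w} → w ≢ u → w ≢ v → deg H w ≤ deg G (f w)
  deg-off≤ {w} w≢u w≢v = begin
    deg H w                ≡⟨ deg≡count H w ⟩
    count (adj? H w)       ≤⟨ count-injection (adj? H w) (adj? G (f w)) f f-inj (off-preserves w≢u w≢v) ⟩
    count (adj? G (f w))   ≡⟨ deg≡count G (f w) ⟨
    deg G (f w)            ∎
    where open ≤-Reasoning

  -- When the image has no spare degree, the injection of neighbourhoods at `w` is onto, so edges of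
  -- G at `f w` pull back to H.
  off-onto : ∀ {w} → w ≢ u → w ≢ v → deg G (f w) ≤ deg H w → ∀ {i} → Adj G (f w) (f i) → Adj H w i
  off-onto {w} w≢u w≢v deg≤ fwfi
    with count-surjection (adj? H w) (adj? G (f w)) f f-inj (off-preserves w≢u w≢v)
           (subst (_≤ _) (deg≡count G (f w)) (subst (_ ≤_) (deg≡count H w) deg≤)) fwfi
  ... | j , wj , fj≡fi = subst (Adj H w) (f-inj fj≡fi) wj

  private
    rest? : Decidable (λ i → Adj H u i × i ≢ v)
    rest? i = adj? H u i ×-dec ¬? (i ≟ v)

    rest-preserves : ∀ i → Adj H u i × i ≢ v → Adj G x (f i)
    rest-preserves i (ui , i≢v) with preserves u i ui
    ... | inj₁ e                = subst (λ z → Adj G z (f i)) fu≡x e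
    ... | inj₂ (inj₁ (_ , i≡v)) = contradiction i≡v i≢v
    ... | inj₂ (inj₂ (u≡v , _)) = contradiction u≡v (Adj⇒≢ H uv)

    deg-u≤ : deg H u ≤ suc (count rest?)
    deg-u≤ = begin
      deg H u                       ≡⟨ deg≡count H u ⟩
      count (adj? H u)              ≤⟨ count-cover (adj? H u) (_≟ v) rest? v-or-rest ⟩
      count (_≟ v) + count rest?    ≡⟨ cong (_+ count rest?) (count-≟ v) ⟩
      suc (count rest?)             ∎
      where
      open ≤-Reasoning
      v-or-rest : ∀ i → Adj H u i → i ≡ v ⊎ (Adj H u i × i ≢ v)
      v-or-rest i ui with i ≟ v
      ... | yes i≡v = inj₁ i≡v
      ... | no  i≢v = inj₂ (ui , i≢v)

  -- All edges at `u` other than `uv` embed at `x`, so the degree drops by at most one.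
  deg-end≤ : deg H u ≤ suc (deg G x)
  deg-end≤ = ≤-trans deg-u≤ (s≤s (≤-trans (count-injection rest? (adj? G x) f f-inj rest-preserves)
                                          (≤-reflexive (≡.sym (deg≡count G x)))))

  end-onto : deg G x < deg H u → ∀ {z} → Adj G x z → ∃[ i ] f i ≡ z × Adj H u i × i ≢ v
  end-onto deg< xz
    with count-surjection rest? (adj? G x) f f-inj rest-preserves
           (subst (_≤ count rest?) (deg≡count G x) (≤-pred (≤-trans deg< deg-u≤))) xz
  ... | i , (ui , i≢v) , fi≡z = i , fi≡z , ui , i≢v

-- Discharging

-- Three cliques of vertices of degree at most `k0` (deficient, lonely, twinned) and at most one
-- starved vertex.
exceptions : ℕ → ℕ
exceptions k0 = suc k0 + (suc k0 + (suc k0 + 1))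

-- Low vertices and the exceptional classes

module LowVertices {G : Graph n} {H : Graph h} (saturated : Saturated G H) (triangleFree : TriangleFree H)
  {k0 k1' : ℕ}
  (k0≤wt0  : ∀ u v → Adj H u v → k0 ≤ wt0 H u v)
  (k1'≤wt1 : ∀ u v → Adj H u v → wt0 H u v ≡ k0 → k1' ≤ wt1 H u v)
  (gap     : 2 + k0 ≤ k1') where

  Low Big Huge : Fin n → Set
  Low x  = deg G x ≤ k0
  Big x  = k1' ≤ deg G x
  Huge x = k1' < deg G x

  HasBig HasHuge : Fin n → Set
  HasBig x  = ∃[ z ] Adj G x z × Big z
  HasHuge x = ∃[ z ] Adj G x z × Huge z

  SameBig : Fin n → Fin n → Set
  SameBig x y = ∀ z → Big z → (Adj G x z → Adj G y z) × (Adj G y z → Adj G x z)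

  Deficient Lonely Twinned : Fin n → Set
  Deficient x = deg G x < k0
  Lonely x    = Low x × ¬ HasBig x
  Twinned x   = Low x × ¬ HasHuge x × ∃[ y ] Adj G x y × Low y × SameBig x y

  low? : Decidable Low
  low? x = deg G x ≤? k0

  big? : Decidable Big
  big? x = k1' ≤? deg G x

  huge? : Decidable Huge
  huge? x = k1' <? deg G x

  hasBig? : Decidable HasBig
  hasBig? x = any? λ z → adj? G x z ×-dec big? z

  hasHuge? : Decidable HasHuge
  hasHuge? x = any? λ z → adj? G x z ×-dec huge? z

  deficient? : Decidable Deficient
  deficient? x = deg G x <? k0

  lonely? : Decidable Lonely
  lonely? x = low? x ×-dec ¬? (hasBig? x)

  twinned? : Decidable Twinned
  twinned? x = low? x ×-dec ¬? (hasHuge? x) ×-dec any? λ y → adj? G x y ×-dec low? y ×-dec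
    all? λ z → big? z →-dec ((adj? G x z →-dec adj? G y z) ×-dec (adj? G y z →-dec adj? G x z))

  -- Such an edge has `wt0` at most `k0`, hence exactly `k0` by minimality, and the bound defining
  -- `k1'` applies.
  light-edge : ∀ {u v} → Adj H u v → deg H u ≤ suc k0 → deg H v ≤ suc k0 → HeavyNeighbour H u v k1'
  light-edge {u} {v} uv du dv = heavyNeighbour H u v (≤-trans (s≤s z≤n) gap)
    (k1'≤wt1 u v uv (≤-antisym (∸-monoˡ-≤ 1 (⊔-lub du dv)) (k0≤wt0 u v uv)))

  module _ {x y : Fin n} (c : NearCopy G H x y) where
    open NearCopy c
    open NearCopyDegrees c

    deg-u≤1+k0 : Low x → deg H u ≤ suc k0
    deg-u≤1+k0 low = ≤-trans deg-end≤ (s≤s low)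

    -- A vertex w whose image has no spare degree uses every edge of G at that image,
    -- so a common neighbour of two H-adjacent images closes a triangle in H.
    saturated-apex : ∀ {a b w} → Adj H a b → w ≢ u → w ≢ v → k1' ≤ deg H w → ¬ Huge (f w) →
                     Adj G (f a) (f w) → Adj G (f b) (f w) → ⊥
    saturated-apex {a} {b} {w} ab w≢u w≢v k1'≤w ¬huge aw bw =
      triangleFree a b w ab (Adj-sym H (onto bw)) (Adj-sym H (onto aw))
      where
      onto : ∀ {i} → Adj G (f i) (f w) → Adj H w i
      onto iw = off-onto w≢u w≢v (≤-trans (≮⇒≥ ¬huge) k1'≤w) (Adj-sym G iw)

  share-big : ∀ {x y z} → SameBig x y → Big z → Adj G x z ⊎ Adj G y z → Adj G x z × Adj G y z
  share-big same bigz (inj₁ xz) = xz , proj₁ (same _ bigz) xz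
  share-big same bigz (inj₂ yz) = proj₂ (same _ bigz) yz , yz

  -- Otherwise the heavy neighbour of the edge playing xy has a big image next to `x` or `y`, hence
  -- next to both. That image is not huge, so `saturated-apex` yields a triangle in H.
  sameBig⇒adjacent : ∀ {x y} → x ≢ y → Low x → Low y → ¬ HasHuge x → SameBig x y → Adj G x y
  sameBig⇒adjacent {x} {y} x≢y lowx lowy ¬hugex same =
    decidable-stable (adj? G x y) λ ¬xy → impossible (nearCopy saturated x≢y ¬xy)
    where
    impossible : NearCopy G H x y → ⊥
    impossible c = apex (light-edge uv (deg-u≤1+k0 c lowx) (deg-u≤1+k0 (flip c) lowy))
      where
      open NearCopy c
      open NearCopyDegrees c
      apex : HeavyNeighbour H u v k1' → ⊥
      apex (heavy {w} w≢u w≢v beside k1'≤w) =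
        saturated-apex c uv w≢u w≢v k1'≤w (λ hg → ¬hugex (f w , proj₁ both , hg))
          (subst (λ z → Adj G z (f w)) (≡.sym fu≡x) (proj₁ both))
          (subst (λ z → Adj G z (f w)) (≡.sym fv≡y) (proj₂ both))
        where
        bigw : Big (f w)
        bigw = ≤-trans k1'≤w (deg-off≤ w≢u w≢v)
        both : Adj G x (f w) × Adj G y (f w)
        both = share-big same bigw (Sum.map (subst (λ z → Adj G z (f w)) fu≡x ∘ off-preserves′ w≢u w≢v)
                                                 (subst (λ z → Adj G z (f w)) fv≡y ∘ off-preserves′ w≢u w≢v) beside)

  -- A new edge between two such vertices would play an edge of H whose ends have degree at most
  -- `k0`, of weight below the minimum.
  deficient-clique : ∀ x y → Deficient x → Deficient y → x ≢ y → Adj G x y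
  deficient-clique x y defx defy x≢y =
    decidable-stable (adj? G x y) λ ¬xy → impossible (nearCopy saturated x≢y ¬xy)
    where
    -- Positivity makes the truncated subtraction in `wt0` strict.
    0<k0 : 0 < k0
    0<k0 = ≤-trans (s≤s z≤n) defx
    impossible : NearCopy G H x y → ⊥
    impossible c = <⇒≱ wt0<k0 (k0≤wt0 u v uv)
      where
      open NearCopy c
      wt0<k0 : wt0 H u v < k0
      wt0<k0 = ≤-trans (s≤s (∸-monoˡ-≤ 1 (⊔-lub (≤-trans (NearCopyDegrees.deg-end≤ c) defx)
                                              (≤-trans (NearCopyDegrees.deg-end≤ (flip c)) defy))))
                       (≤-reflexive (m+[n∸m]≡n 0<k0))

  -- Without big neighbours, `SameBig` holds vacuously.
  lonely-clique : ∀ x y → Lonely x → Lonely y → x ≢ y → Adj G x y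
  lonely-clique x y (lowx , ¬bigx) (lowy , ¬bigy) x≢y =
    sameBig⇒adjacent x≢y lowx lowy (λ { (z , xz , hz) → ¬bigx (z , xz , <⇒≤ hz) })
      (λ z bz → (λ xz → contradiction (z , xz , bz) ¬bigx) , (λ yz → contradiction (z , yz , bz) ¬bigy))

  -- If d(u) = k0 + 1 then x spends all its edges on the copy, so its twin is the image of a
  -- neighbour u₂ of u, and the edge u u₂ has weight k0 as well.
  twinned-end : ∀ {x y} (c : NearCopy G H x y) → Twinned x → Low y → deg H (NearCopy.u c) ≤ k0
  twinned-end {x} {y} c (lowx , ¬hugex , x₂ , xx₂ , lowx₂ , same) lowy =
    ≮⇒≥ λ k0<du → impossible (end-onto (≤-trans (s≤s lowx) k0<du) xx₂)
    where
    open NearCopy c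
    open NearCopyDegrees c
    impossible : (∃[ i ] f i ≡ x₂ × Adj H u i × i ≢ v) → ⊥
    impossible (u₂ , fu₂≡x₂ , uu₂ , u₂≢v) = apex (light-edge uu₂ (deg-u≤1+k0 c lowx) du₂)
      where
      u₂≢u : u₂ ≢ u
      u₂≢u = Adj⇒≢ H (Adj-sym H uu₂)
      du₂ : deg H u₂ ≤ suc k0
      du₂ = ≤-trans (deg-off≤ u₂≢u u₂≢v) (≤-trans (≤-trans (≤-reflexive (cong (deg G) fu₂≡x₂)) lowx₂) (n≤1+n k0))
      apex : HeavyNeighbour H u u₂ k1' → ⊥
      apex (heavy {w} w≢u w≢u₂ beside k1'≤w) =
        saturated-apex c uu₂ w≢u w≢v k1'≤w (λ hg → ¬hugex (f w , proj₁ both , hg))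
          (subst (λ z → Adj G z (f w)) (≡.sym fu≡x) (proj₁ both))
          (subst (λ z → Adj G z (f w)) (≡.sym fu₂≡x₂) (proj₂ both))
        where
        -- The apex was chosen off `u u₂`, so `v` must be excluded separately: `y` is low, so `v`
        -- has degree at most `k0 + 1`, below `k1'`.
        w≢v : w ≢ v
        w≢v refl = <⇒≱ (≤-trans gap k1'≤w) (deg-u≤1+k0 (flip c) lowy)
        bigw : Big (f w)
        bigw = ≤-trans k1'≤w (deg-off≤ w≢u w≢v)
        both : Adj G x (f w) × Adj G x₂ (f w)
        both = share-big same bigw (Sum.map (subst (λ z → Adj G z (f w)) fu≡x ∘ off-preserves′ w≢u w≢v)
                                                 (subst (λ z → Adj G z (f w)) fu₂≡x₂ ∘ off-preserves′ w≢u w≢v) beside)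

  -- By `twinned-end` from both sides, the edge playing xy has both end degrees at most `k0`, so its
  -- weight is below `k0`.
  twinned-clique : ∀ x y → Twinned x → Twinned y → x ≢ y → Adj G x y
  twinned-clique x y twx twy x≢y =
    decidable-stable (adj? G x y) λ ¬xy → impossible (nearCopy saturated x≢y ¬xy)
    where
    impossible : NearCopy G H x y → ⊥
    impossible c = <⇒≱ (≤-trans (s≤s (k0≤wt0 u v uv)) (≤-reflexive (m+[n∸m]≡n 0<max)))
                       (⊔-lub (twinned-end c twx (proj₁ twy)) (twinned-end (flip c) twy (proj₁ twx)))
      where
      open NearCopy c
      0<max : 0 < deg H u ⊔ deg H v
      0<max = ≤-trans (Adj⇒0<deg H uv) (m≤m⊔n _ _)

  lowNeighbour? : ∀ v → Decidable (λ x → Adj G v x × Low x)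
  lowNeighbour? v x = adj? G v x ×-dec low? x

  lowDeg : Fin n → ℕ
  lowDeg v = count (lowNeighbour? v)

  -- A vertex above degree `k0` with fewer than `a` non-low neighbours: impossible for `a = 0`, all
  -- neighbours low for `a = 1`.
  Starved : ℕ → Fin n → Set
  Starved a v = k0 < deg G v × ¬ (a + lowDeg v ≤ deg G v)

  starved⇒neighbours-low : ∀ {v z} → Starved 1 v → Adj G v z → Low z
  starved⇒neighbours-low {v} {z} (_ , ¬fed) vz = decidable-stable (low? z) λ ¬low → ¬fed (begin
    1 + lowDeg v               ≡⟨ cong (_+ lowDeg v) (count-≟ z) ⟨
    count (_≟ z) + lowDeg v    ≤⟨ count-disjoint (_≟ z) (lowNeighbour? v) (adj? G v) (λ { _ refl → vz }) (λ _ → proj₁) (λ { _ refl → ¬low ∘ proj₂ }) ⟩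
    count (adj? G v)           ≡⟨ deg≡count G v ⟨
    deg G v                    ∎)
    where open ≤-Reasoning

  -- Two starved vertices are not low, hence not adjacent. Joining them gives a copy in which some w
  -- in N(uv) has degree above `k0`; its image is a non-low neighbour of one of them.
  starved-unique : (∀ u v → Adj H u v → k0 < wt1 H u v) → ∀ x y → Starved 1 x → Starved 1 y → x ≡ y
  starved-unique k0<wt1 x y sx sy = decidable-stable (x ≟ y) λ x≢y → impossible (nearCopy saturated x≢y nonadjacent)
    where
    nonadjacent : ¬ Adj G x y
    nonadjacent xy = <⇒≱ (proj₁ sy) (starved⇒neighbours-low sx xy)
    impossible : NearCopy G H x y → ⊥
    impossible c = apex (heavyNeighbour H u v (s≤s z≤n) (k0<wt1 u v uv))
      where
      open NearCopy c
      open NearCopyDegrees c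
      apex : HeavyNeighbour H u v (suc k0) → ⊥
      apex (heavy {w} w≢u w≢v beside k0<w) = <⇒≱ (≤-trans k0<w (deg-off≤ w≢u w≢v))
        ([ starved⇒neighbours-low sx ∘ subst (λ z → Adj G z (f w)) fu≡x ∘ off-preserves′ w≢u w≢v
         , starved⇒neighbours-low sy ∘ subst (λ z → Adj G z (f w)) fv≡y ∘ off-preserves′ w≢u w≢v ] beside)

  -- The discharging rule and its accounting

  -- The target average degree is `k0 + R / K`, and `a` counts the non-low neighbours guaranteed at
  -- a paying vertex. The two hypotheses say that a huge vertex, and one of degree `k1'`, can pay
  -- `l` low neighbours and still keep the target.
  module Discharging (K R a : ℕ) (R≤K : R ≤ K)
    (huge-affords  : ∀ D l → k1' < D → a + l ≤ D → K * k0 + R + R * l ≤ K * D)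
    (tight-affords : ∀ l → a + l ≤ k1' → 2 * (K * k0 + R) + (R * l + R) ≤ 2 * (K * k1'))
    where

    bigNeighbour? : ∀ x → Decidable (λ z → Adj G x z × Big z)
    bigNeighbour? x z = adj? G x z ×-dec big? z

    bigDeg : Fin n → ℕ
    bigDeg x = count (bigNeighbour? x)

    lowDeg≤deg : ∀ v → lowDeg v ≤ deg G v
    lowDeg≤deg v = ≤-trans (count-mono (lowNeighbour? v) (adj? G v) (λ _ → proj₁)) (≤-reflexive (≡.sym (deg≡count G v)))

    -- Settled vertices receive nothing from vertices of degree `k1'`: a huge neighbour pays them,
    -- or they are written off as twinned.
    Settled Exceptional : Fin n → Set
    Settled x     = HasHuge x ⊎ Twinned x
    Exceptional v = Deficient v ⊎ Lonely v ⊎ Twinned v ⊎ Starved a v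

    starved? : Decidable (Starved a)
    starved? v = (k0 <? deg G v) ×-dec ¬? (a + lowDeg v ≤? deg G v)

    settled? : Decidable Settled
    settled? x = hasHuge? x ⊎-dec twinned? x

    exceptional? : Decidable Exceptional
    exceptional? v = deficient? v ⊎-dec lonely? v ⊎-dec twinned? v ⊎-dec starved? v

    share : Dec A → ℕ
    share (yes _) = 2 * R
    share (no  _) = R

    -- The decisions are, in order: payer huge, payer big, receiver settled, receiver with at most
    -- one big neighbour. Huge payers come first, so they pay settled vertices too.
    rate : Dec A → Dec B → Dec C → Dec D → ℕ
    rate (yes _) _       _       _    = 2 * R
    rate (no  _) (no  _) _       _    = 0
    rate (no  _) (yes _) (yes _) _    = 0
    rate (no  _) (yes _) (no  _) solo = share solo

    -- What v sends to x, in units of 1/(2K).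
    payment : Fin n → Fin n → ℕ
    payment v x = ⟦ lowNeighbour? v x ⟧ * rate (huge? v) (big? v) (settled? x) (bigDeg x ≤? 1)

    R≤2R : R ≤ 2 * R
    R≤2R = m≤m+n R _

    rate≤2R : (p : Dec A) (q : Dec B) (r : Dec C) (s : Dec D) → rate p q r s ≤ 2 * R
    rate≤2R (yes _) _       _       _       = ≤-refl
    rate≤2R (no  _) (no  _) _       _       = z≤n
    rate≤2R (no  _) (yes _) (yes _) _       = z≤n
    rate≤2R (no  _) (yes _) (no  _) (yes _) = ≤-refl
    rate≤2R (no  _) (yes _) (no  _) (no  _) = R≤2R

    rate-huge : (p : Dec A) (q : Dec B) (r : Dec C) (s : Dec D) → A → rate p q r s ≡ 2 * R
    rate-huge (yes _) _ _ _ _ = refl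
    rate-huge (no ¬a) _ _ _ a = contradiction a ¬a

    rate-not-big : (p : Dec A) (q : Dec B) (r : Dec C) (s : Dec D) → ¬ A → ¬ B → rate p q r s ≡ 0
    rate-not-big (yes a) _       _ _ ¬a _  = contradiction a ¬a
    rate-not-big (no _)  (yes b) _ _ _  ¬b = contradiction b ¬b
    rate-not-big (no _)  (no _)  _ _ _  _  = refl

    share≤rate : (p : Dec A) (q : Dec B) (r : Dec C) (s : Dec D) → B → ¬ C → share s ≤ rate p q r s
    share≤rate (yes _) _       _       (yes _) _ _  = ≤-refl
    share≤rate (yes _) _       _       (no  _) _ _  = R≤2R
    share≤rate (no  _) (no ¬b) _       _       b _  = contradiction b ¬b
    share≤rate (no  _) (yes _) (yes c) _       _ ¬c = contradiction c ¬c
    share≤rate (no  _) (yes _) (no  _) _       _ _  = ≤-refl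

    rate-tight : {E : Set} (p : Dec A) (q : Dec B) (r : Dec C) (s : Dec D) (e : Dec E) →
                 ¬ A → (¬ C → D → E) → rate p q r s ≤ R + R * ⟦ e ⟧
    rate-tight (yes a) _       _       _       e ¬a _ = contradiction a ¬a
    rate-tight (no  _) (no  _) _       _       e _  _ = z≤n
    rate-tight (no  _) (yes _) (yes _) _       e _  _ = z≤n
    rate-tight (no  _) (yes _) (no  _) (no  _) e _  _ = m≤m+n R _
    rate-tight (no  _) (yes _) (no ¬c) (yes d) e _  f =
      ≤-reflexive (cong (_+_ R) (trans (*-comm 1 R) (cong (R *_) (≡.sym (⟦⟧-true e (f ¬c d))))))

    out≤ : ∀ v → ∑ (payment v) ≤ 2 * R * lowDeg v
    out≤ v = begin
      ∑ (payment v)                              ≤⟨ ∑-mono (λ x → *-monoʳ-≤ ⟦ lowNeighbour? v x ⟧ (rate≤2R (huge? v) (big? v) (settled? x) (bigDeg x ≤? 1))) ⟩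
      ∑ (λ x → ⟦ lowNeighbour? v x ⟧ * (2 * R))  ≡⟨ *-distribʳ-sum (2 * R) (λ x → ⟦ lowNeighbour? v x ⟧) ⟨
      lowDeg v * (2 * R)                         ≡⟨ *-comm (lowDeg v) (2 * R) ⟩
      2 * R * lowDeg v                           ∎
      where open ≤-Reasoning

    out-not-big : ∀ v → ¬ Big v → ∑ (payment v) ≡ 0
    out-not-big v ¬big = ∑-zero λ x →
      trans (cong (⟦ lowNeighbour? v x ⟧ *_) (rate-not-big (huge? v) (big? v) (settled? x) (bigDeg x ≤? 1) (¬big ∘ <⇒≤) ¬big))
            (*-zeroʳ ⟦ lowNeighbour? v x ⟧)

    Solo : Fin n → Fin n → Set
    Solo v x = Adj G v x × Low x × ¬ Settled x × bigDeg x ≤ 1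

    solo? : ∀ v → Decidable (Solo v)
    solo? v x = adj? G v x ×-dec low? x ×-dec ¬? (settled? x) ×-dec bigDeg x ≤? 1

    -- Two solo neighbours of `v` both have `v` as their only big neighbour, so they are adjacent
    -- twins, and `x` would be settled.
    solo-unique : ∀ v → Big v → ∀ x y → Solo v x → Solo v y → x ≡ y
    solo-unique v bigv x y (vx , lowx , ¬setx , solox) (vy , lowy , ¬sety , soloy) =
      decidable-stable (x ≟ y) λ x≢y →
        ¬setx (inj₂ (lowx , ¬setx ∘ inj₁ , y , sameBig⇒adjacent x≢y lowx lowy (¬setx ∘ inj₁) same , lowy , same))
      where
      only-v : ∀ {x z} → Adj G v x → bigDeg x ≤ 1 → Big z → Adj G x z → z ≡ v
      only-v {x} vx solo bigz xz = count<2⇒unique (bigNeighbour? x) solo (xz , bigz) (Adj-sym G vx , bigv)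
      same : SameBig x y
      same z bigz = (λ xz → subst (Adj G y) (≡.sym (only-v vx solox bigz xz)) (Adj-sym G vy))
                  , (λ yz → subst (Adj G x) (≡.sym (only-v vy soloy bigz yz)) (Adj-sym G vx))

    -- Each low neighbour costs at most `R`, and the surcharge `R` for a solo neighbour occurs at
    -- most once.
    out-tight : ∀ v → Big v → ¬ Huge v → ∑ (payment v) ≤ R * lowDeg v + R
    out-tight v bigv ¬huge = begin
      ∑ (payment v)                                                             ≤⟨ ∑-mono pointwise ⟩
      ∑ (λ x → R * ⟦ lowNeighbour? v x ⟧ + R * ⟦ solo? v x ⟧)                   ≡⟨ ∑-distrib-+ (λ x → R * ⟦ lowNeighbour? v x ⟧) (λ x → R * ⟦ solo? v x ⟧) ⟩
      ∑ (λ x → R * ⟦ lowNeighbour? v x ⟧) + ∑ (λ x → R * ⟦ solo? v x ⟧)         ≡⟨ cong₂ _+_ (*-distribˡ-sum R (λ x → ⟦ lowNeighbour? v x ⟧)) (*-distribˡ-sum R (λ x → ⟦ solo? v x ⟧)) ⟨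
      R * lowDeg v + R * count (solo? v)                                        ≤⟨ +-monoʳ-≤ (R * lowDeg v) (*-monoʳ-≤ R (count-subsingleton (solo? v) (solo-unique v bigv))) ⟩
      R * lowDeg v + R * 1                                                      ≡⟨ cong (_+_ (R * lowDeg v)) (*-identityʳ R) ⟩
      R * lowDeg v + R                                                          ∎
      where
      open ≤-Reasoning
      pointwise : ∀ x → payment v x ≤ R * ⟦ lowNeighbour? v x ⟧ + R * ⟦ solo? v x ⟧
      pointwise x = byCase (lowNeighbour? v x)
        where
        byCase : (l : Dec (Adj G v x × Low x)) →
                 ⟦ l ⟧ * rate (huge? v) (big? v) (settled? x) (bigDeg x ≤? 1) ≤ R * ⟦ l ⟧ + R * ⟦ solo? v x ⟧
        byCase (no _)            = z≤n
        byCase (yes (vx , lowx)) = begin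
          1 * rate (huge? v) (big? v) (settled? x) (bigDeg x ≤? 1)   ≡⟨ *-identityˡ _ ⟩
          rate (huge? v) (big? v) (settled? x) (bigDeg x ≤? 1)       ≤⟨ rate-tight (huge? v) (big? v) (settled? x) (bigDeg x ≤? 1) (solo? v x) ¬huge (λ ¬set solo → vx , lowx , ¬set , solo) ⟩
          R + R * ⟦ solo? v x ⟧                                      ≡⟨ cong (_+ R * ⟦ solo? v x ⟧) (*-identityʳ R) ⟨
          R * 1 + R * ⟦ solo? v x ⟧                                  ∎

    -- Either a huge neighbour sends `2 * R` alone, or a single big neighbour does, or at least two
    -- big neighbours send `R` each.
    in≥ : ∀ x → Low x → ¬ Lonely x → ¬ Twinned x → 2 * R ≤ ∑ (λ v → payment v x)
    in≥ x low ¬lonely ¬twinned = byCase (hasHuge? x)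
      where
      open ≤-Reasoning
      enough : ∀ {A : Set} d (s : Dec A) → 0 < d → (¬ A → 1 < d) → 2 * R ≤ d * share s
      enough d (yes _) 0<d _ = ≤-trans (≤-reflexive (≡.sym (*-identityˡ (2 * R)))) (*-monoˡ-≤ (2 * R) 0<d)
      enough d (no ¬a) _ 1<d = *-monoˡ-≤ R (1<d ¬a)
      0<bigDeg : 0 < bigDeg x
      0<bigDeg with decidable-stable (hasBig? x) (λ ¬big → ¬lonely (low , ¬big))
      ... | z , xz = ≤-trans (≤-reflexive (≡.sym (⟦⟧-true (bigNeighbour? x z) xz))) (term≤∑ (λ z → ⟦ bigNeighbour? x z ⟧) z)
      byCase : Dec (HasHuge x) → 2 * R ≤ ∑ (λ v → payment v x)
      byCase (yes (z , xz , hugez)) = begin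
        2 * R                       ≡⟨ *-identityˡ (2 * R) ⟨
        1 * (2 * R)                 ≡⟨ cong₂ _*_ (⟦⟧-true (lowNeighbour? z x) (Adj-sym G xz , low)) (rate-huge (huge? z) (big? z) (settled? x) (bigDeg x ≤? 1) hugez) ⟨
        payment z x                 ≤⟨ term≤∑ (λ v → payment v x) z ⟩
        ∑ (λ v → payment v x)       ∎
      byCase (no ¬huge) = begin
        2 * R                                                          ≤⟨ enough (bigDeg x) (bigDeg x ≤? 1) 0<bigDeg ≰⇒> ⟩
        bigDeg x * share (bigDeg x ≤? 1)                               ≡⟨ *-distribʳ-sum (share (bigDeg x ≤? 1)) (λ z → ⟦ bigNeighbour? x z ⟧) ⟩
        ∑ (λ z → ⟦ bigNeighbour? x z ⟧ * share (bigDeg x ≤? 1))        ≤⟨ ∑-mono (λ z → pointwise z (bigNeighbour? x z)) ⟩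
        ∑ (λ v → payment v x)                                          ∎
        where
        pointwise : ∀ z (b : Dec (Adj G x z × Big z)) → ⟦ b ⟧ * share (bigDeg x ≤? 1) ≤ payment z x
        pointwise z (no _)            = z≤n
        pointwise z (yes (xz , bigz)) = *-mono-≤ (≤-reflexive (≡.sym (⟦⟧-true (lowNeighbour? z x) (Adj-sym G xz , low))))
          (share≤rate (huge? z) (big? z) (settled? x) (bigDeg x ≤? 1) bigz [ ¬huge , ¬twinned ])

    base : ℕ
    base = K * k0 + R

    -- The charge balance at one vertex, scaled by `2 * K`; an exceptional vertex is credited the
    -- whole target `2 * base`.
    local : ∀ v → 2 * base + ∑ (payment v) ≤
                  2 * K * deg G v + ∑ (λ w → payment w v) + 2 * base * ⟦ exceptional? v ⟧
    local v = byCase (exceptional? v)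
      where
      open ≤-Reasoning
      out = ∑ (payment v)
      inn = ∑ (λ w → payment w v)
      d   = deg G v

      regular : ¬ Exceptional v → Dec (Low v) → Dec (Big v) → 2 * base + out ≤ 2 * K * d + inn
      regular ¬exc (yes low) _ = begin
        2 * base + out         ≡⟨ cong (_+_ (2 * base)) (out-not-big v (<⇒≱ (≤-trans (s≤s low) (≤-trans (n≤1+n _) gap)))) ⟩
        2 * base + 0           ≡⟨ regroup K k0 R ⟩
        2 * K * k0 + 2 * R     ≤⟨ +-mono-≤ (*-monoʳ-≤ (2 * K) (≮⇒≥ (¬exc ∘ inj₁))) (in≥ v low (¬exc ∘ inj₂ ∘ inj₁) (¬exc ∘ inj₂ ∘ inj₂ ∘ inj₁)) ⟩
        2 * K * d + inn        ∎
        where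
        regroup : ∀ K k0 R → 2 * (K * k0 + R) + 0 ≡ 2 * K * k0 + 2 * R
        regroup = solve-∀
      -- Nothing is sent, and degree at least `k0 + 1` already meets the target since `R ≤ K`.
      regular ¬exc (no ¬low) (no ¬big) = begin
        2 * base + out           ≡⟨ cong (_+_ (2 * base)) (out-not-big v ¬big) ⟩
        2 * base + 0             ≤⟨ +-monoˡ-≤ 0 (*-monoʳ-≤ 2 (+-monoʳ-≤ (K * k0) R≤K)) ⟩
        2 * (K * k0 + K) + 0     ≡⟨ regroup K k0 ⟩
        2 * K * suc k0           ≤⟨ *-monoʳ-≤ (2 * K) (≰⇒> ¬low) ⟩
        2 * K * d                ≤⟨ m≤m+n _ _ ⟩
        2 * K * d + inn          ∎
        where
        regroup : ∀ K k0 → 2 * (K * k0 + K) + 0 ≡ 2 * K * suc k0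
        regroup = solve-∀
      regular ¬exc (no ¬low) (yes big) = ≤-trans (afford (huge? v)) (m≤m+n _ _)
        where
        fed : a + lowDeg v ≤ d
        fed = decidable-stable (a + lowDeg v ≤? d) λ ¬fed → ¬exc (inj₂ (inj₂ (inj₂ (≰⇒> ¬low , ¬fed))))
        afford : Dec (Huge v) → 2 * base + out ≤ 2 * K * d
        afford (yes huge) = begin
          2 * base + out                     ≤⟨ +-monoʳ-≤ (2 * base) (out≤ v) ⟩
          2 * base + 2 * R * lowDeg v        ≡⟨ regroup base R (lowDeg v) ⟩
          2 * (base + R * lowDeg v)          ≤⟨ *-monoʳ-≤ 2 (huge-affords d (lowDeg v) huge fed) ⟩
          2 * (K * d)                        ≡⟨ *-assoc 2 K d ⟨
          2 * K * d                          ∎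
          where
          regroup : ∀ b R l → 2 * b + 2 * R * l ≡ 2 * (b + R * l)
          regroup = solve-∀
        afford (no ¬huge) = begin
          2 * base + out                     ≤⟨ +-monoʳ-≤ (2 * base) (out-tight v big ¬huge) ⟩
          2 * base + (R * lowDeg v + R)      ≤⟨ tight-affords (lowDeg v) (≤-trans fed (≮⇒≥ ¬huge)) ⟩
          2 * (K * k1')                      ≤⟨ *-monoʳ-≤ 2 (*-monoʳ-≤ K big) ⟩
          2 * (K * d)                        ≡⟨ *-assoc 2 K d ⟨
          2 * K * d                          ∎

      byCase : (e : Dec (Exceptional v)) → 2 * base + out ≤ 2 * K * d + inn + 2 * base * ⟦ e ⟧
      byCase (no ¬exc) = ≤-trans (regular ¬exc (low? v) (big? v)) (m≤m+n _ _)
      byCase (yes _)   = begin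
        -- The credit covers the target, and the degree alone covers the payments, as `R ≤ K` and
        -- `lowDeg v ≤ deg G v`.
        2 * base + out                 ≤⟨ +-monoʳ-≤ (2 * base) (≤-trans (out≤ v) (*-mono-≤ (*-monoʳ-≤ 2 R≤K) (lowDeg≤deg v))) ⟩
        2 * base + 2 * K * d           ≡⟨ +-comm (2 * base) (2 * K * d) ⟩
        2 * K * d + 2 * base           ≤⟨ +-monoˡ-≤ (2 * base) (m≤m+n (2 * K * d) inn) ⟩
        2 * K * d + inn + 2 * base     ≡⟨ cong (_+_ (2 * K * d + inn)) (*-identityʳ (2 * base)) ⟨
        2 * K * d + inn + 2 * base * 1 ∎

    module _ (unique : ∀ x y → Starved a x → Starved a y → x ≡ y) where

      few-exceptional : count exceptional? ≤ exceptions k0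
      few-exceptional =
        ≤-trans (count-cover exceptional? deficient? (λ v → lonely? v ⊎-dec twinned? v ⊎-dec starved? v) (λ _ → id))
          (+-mono-≤ (clique-size G deficient? k0 (λ _ → <⇒≤) deficient-clique)
        (≤-trans (count-cover (λ v → lonely? v ⊎-dec twinned? v ⊎-dec starved? v) lonely? (λ v → twinned? v ⊎-dec starved? v) (λ _ → id))
          (+-mono-≤ (clique-size G lonely? k0 (λ _ → proj₁) lonely-clique)
        (≤-trans (count-cover (λ v → twinned? v ⊎-dec starved? v) twinned? starved? (λ _ → id))
          (+-mono-≤ (clique-size G twinned? k0 (λ _ → proj₁) twinned-clique)
                    (count-subsingleton starved? unique))))))

      -- Sum `local` over all vertices: the total sent equals the total received by exchanging sums,
      -- and cancels.
      global : n * base ≤ 2 * K * edges G + base * exceptions k0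
      global = *-cancelˡ-≤ 2 (+-cancelʳ-≤ total _ _ (begin
        2 * (n * base) + total                                     ≡⟨ cong (_+ total) (trans (swap₂ n base) (≡.sym (∑-const n (2 * base)))) ⟩
        ∑ {n} (λ _ → 2 * base) + total                             ≡⟨ ∑-distrib-+ (λ _ → 2 * base) out ⟨
        ∑ (λ v → 2 * base + out v)                                 ≤⟨ ∑-mono local ⟩
        ∑ (λ v → 2 * K * deg G v + inn v + exc v)                  ≡⟨ ∑-distrib-+ (λ v → 2 * K * deg G v + inn v) exc ⟩
        ∑ (λ v → 2 * K * deg G v + inn v) + ∑ exc                  ≡⟨ cong (_+ ∑ exc) (∑-distrib-+ (λ v → 2 * K * deg G v) inn) ⟩
        ∑ (λ v → 2 * K * deg G v) + ∑ inn + ∑ exc                  ≡⟨ cong₂ (λ p q → p + ∑ inn + q) (*-distribˡ-sum (2 * K) (deg G)) (*-distribˡ-sum (2 * base) (λ v → ⟦ exceptional? v ⟧)) ⟨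
        2 * K * ∑ (deg G) + ∑ inn + 2 * base * count exceptional?  ≡⟨ cong (λ t → 2 * K * ∑ (deg G) + t + 2 * base * count exceptional?) (∑-comm payment) ⟨
        2 * K * ∑ (deg G) + total + 2 * base * count exceptional?  ≤⟨ +-mono-≤ (+-monoˡ-≤ total (*-monoʳ-≤ (2 * K) (∑deg≤2edges G))) (*-monoʳ-≤ (2 * base) few-exceptional) ⟩
        2 * K * (2 * edges G) + total + 2 * base * exceptions k0      ≡⟨ regroup K (edges G) total base (exceptions k0) ⟩
        2 * (2 * K * edges G + base * exceptions k0) + total          ∎))
        where
        open ≤-Reasoning
        out inn exc : Fin n → ℕ
        out v = ∑ (payment v)
        inn v = ∑ (λ w → payment w v)
        exc v = 2 * base * ⟦ exceptional? v ⟧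
        total : ℕ
        total = ∑ out
        swap₂ : ∀ n b → 2 * (n * b) ≡ n * (2 * b)
        swap₂ = solve-∀
        regroup : ∀ K e t b x → 2 * K * (2 * e) + t + 2 * b * x ≡ 2 * (2 * K * e + b * x) + t
        regroup = solve-∀

-- From natural numbers to the rational bound

≤⇒bound : ∀ k0 R K-1 n e C {z : ℤ} → z ≡ + R → let K = suc K-1 in
          n * (K * k0 + R) ≤ 2 * K * e + 2 * K * C →
          ((+ k0 / 1) ℚ.+ (z / K)) ℚ.* (+ n / 2) ℚ.- (+ C / 1) ℚ.≤ (+ e / 1)
≤⇒bound k0 R K-1 n e C refl N≤ = ℚ.toℚᵘ-cancel-≤ (begin
  ℚ.toℚᵘ (p ℚ.* q ℚ.- r)                                                 ≃⟨ ℚ.toℚᵘ-homo-+ (p ℚ.* q) (ℚ.- r) ⟩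
  ℚ.toℚᵘ (p ℚ.* q) ℚᵘ.+ ℚ.toℚᵘ (ℚ.- r)                                   ≃⟨ ℚᵘ.+-cong (ℚ.toℚᵘ-homo-* p q) (ℚ.toℚᵘ-homo‿- r) ⟩
  ℚ.toℚᵘ p ℚᵘ.* ℚ.toℚᵘ q ℚᵘ.+ ℚᵘ.- ℚ.toℚᵘ r                              ≃⟨ ℚᵘ.+-cong (ℚᵘ.*-cong p≃ (ℚ.toℚᵘ-fromℚᵘ (mkℚᵘ (+ n) 1))) (ℚᵘ.-‿cong (ℚ.toℚᵘ-fromℚᵘ (mkℚᵘ (+ C) 0))) ⟩
  (mkℚᵘ (+ k0) 0 ℚᵘ.+ mkℚᵘ (+ R) K-1) ℚᵘ.* mkℚᵘ (+ n) 1 ℚᵘ.- mkℚᵘ (+ C) 0 ≤⟨ ℚᵘ.*≤* cleared ⟩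
  mkℚᵘ (+ e) 0                                                           ≃⟨ ℚ.toℚᵘ-fromℚᵘ (mkℚᵘ (+ e) 0) ⟨
  ℚ.toℚᵘ (+ e / 1)                                                       ∎)
  where
  open ℚᵘ.≤-Reasoning
  K = suc K-1
  p = (+ k0 / 1) ℚ.+ (+ R / K)
  q = + n / 2
  r = + C / 1
  p≃ : ℚ.toℚᵘ p ℚᵘ.≃ mkℚᵘ (+ k0) 0 ℚᵘ.+ mkℚᵘ (+ R) K-1
  p≃ = ℚᵘ.≃-trans (ℚ.toℚᵘ-homo-+ (+ k0 / 1) (+ R / K))
                  (ℚᵘ.+-cong (ℚ.toℚᵘ-fromℚᵘ (mkℚᵘ (+ k0) 0)) (ℚ.toℚᵘ-fromℚᵘ (mkℚᵘ (+ R) K-1)))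
  denominator : + (1 * K * 2) ≡ + K ℤ.* + 2
  denominator = trans (cong (λ d → + (d * 2)) (*-identityˡ K)) (ℤ.pos-* K 2)
  pos-numerator : + (n * (K * k0 + R)) ≡ + n ℤ.* (+ K ℤ.* + k0 ℤ.+ + R)
  pos-numerator = trans (ℤ.pos-* n (K * k0 + R)) (cong (λ t → + n ℤ.* (t ℤ.+ + R)) (ℤ.pos-* K k0))
  pos-2K : ∀ m → + (2 * K * m) ≡ + 2 ℤ.* + K ℤ.* + m
  pos-2K m = trans (ℤ.pos-* (2 * K) m) (cong (ℤ._* + m) (ℤ.pos-* 2 K))
  lhs : ∀ k0 K R n C → ((k0 ℤ.* K ℤ.+ R ℤ.* + 1) ℤ.* n ℤ.* + 1 ℤ.+ ℤ.- C ℤ.* (K ℤ.* + 2)) ℤ.* + 1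
                     ≡ n ℤ.* (K ℤ.* k0 ℤ.+ R) ℤ.- + 2 ℤ.* K ℤ.* C
  lhs = ℤ.solve-∀
  rhs : ∀ K e C → + 2 ℤ.* K ℤ.* e ℤ.+ + 2 ℤ.* K ℤ.* C ℤ.- + 2 ℤ.* K ℤ.* C ≡ e ℤ.* (K ℤ.* + 2)
  rhs = ℤ.solve-∀
  cleared : ((+ k0 ℤ.* + K ℤ.+ + R ℤ.* + 1) ℤ.* + n ℤ.* + 1 ℤ.+ ℤ.- (+ C) ℤ.* + (1 * K * 2)) ℤ.* + 1
            ℤ.≤ + e ℤ.* + (1 * K * 2 * 1)
  cleared = ℤ.≤-trans (ℤ.≤-reflexive (trans
      (cong (λ d → ((+ k0 ℤ.* + K ℤ.+ + R ℤ.* + 1) ℤ.* + n ℤ.* + 1 ℤ.+ ℤ.- (+ C) ℤ.* d) ℤ.* + 1) denominator)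
      (lhs (+ k0) (+ K) (+ R) (+ n) (+ C))))
    (ℤ.≤-trans (ℤ.+-monoˡ-≤ (ℤ.- (+ 2 ℤ.* + K ℤ.* + C))
       (≡.subst₂ ℤ._≤_ pos-numerator (cong₂ ℤ._+_ (pos-2K e) (pos-2K C)) (ℤ.+≤+ N≤)))
     (ℤ.≤-reflexive (trans (rhs (+ K) (+ e) (+ C))
       (cong (+ e ℤ.*_) (≡.sym (trans (cong +_ (*-identityʳ (1 * K * 2))) denominator))))))

-- Affordability for the two denominators

module _ (k0 j : ℕ) where

  private
    -- Here `j` stands for `k1' - (k0 + 2)`, so `R` is `k1' + 1 - k0`; the denominators `k1' + 2`
    -- and `k1' + 1` become `4 + k0 + j` and `3 + k0 + j`.
    R = 3 + j

  huge-affords₀ : ∀ D l → 2 + k0 + j < D → l ≤ D → (4 + k0 + j) * k0 + R + R * l ≤ (4 + k0 + j) * D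
  huge-affords₀ D l k1'<D l≤D with m≤n⇒∃[o]m+o≡n k1'<D
  -- `e` is the excess of `D` over `k1' + 1`; the slack `suc k0 * e` vanishes at the smallest huge
  -- degree.
  ... | e , refl = ≤-trans (+-monoʳ-≤ ((4 + k0 + j) * k0 + R) (*-monoʳ-≤ R l≤D))
                           (≤-trans (m≤m+n _ (suc k0 * e)) (≤-reflexive (identity k0 j e)))
    where
    identity : ∀ k0 j e → (4 + k0 + j) * k0 + (3 + j) + (3 + j) * (3 + k0 + j + e) + suc k0 * e ≡ (4 + k0 + j) * (3 + k0 + j + e)
    identity = solve-∀

  tight-affords₀ : ∀ l → l ≤ 2 + k0 + j →
                   2 * ((4 + k0 + j) * k0 + R) + (R * l + R) ≤ 2 * ((4 + k0 + j) * (2 + k0 + j))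
  tight-affords₀ l l≤k1' =
    ≤-trans (+-monoʳ-≤ (2 * ((4 + k0 + j) * k0 + R)) (+-monoˡ-≤ R (*-monoʳ-≤ R l≤k1')))
            (≤-trans (m≤m+n _ (suc j * k0 + j * j + 4 * j + 1)) (≤-reflexive (identity k0 j)))
    where
    identity : ∀ k0 j → 2 * ((4 + k0 + j) * k0 + (3 + j)) + ((3 + j) * (2 + k0 + j) + (3 + j)) + (suc j * k0 + j * j + 4 * j + 1)
                      ≡ 2 * ((4 + k0 + j) * (2 + k0 + j))
    identity = solve-∀

  huge-affords₁ : ∀ D l → 2 + k0 + j < D → 1 + l ≤ D → (3 + k0 + j) * k0 + R + R * l ≤ (3 + k0 + j) * D
  huge-affords₁ D l k1'<D l<D with m≤n⇒∃[o]m+o≡n k1'<D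
  ... | e , refl = begin
    -- The neighbour that need not be paid absorbs the vertex's own `R`, which is what allows the
    -- smaller denominator.
    (3 + k0 + j) * k0 + R + R * l                       ≡⟨ regroup ((3 + k0 + j) * k0) R l ⟩
    (3 + k0 + j) * k0 + R * suc l                       ≤⟨ +-monoʳ-≤ ((3 + k0 + j) * k0) (*-monoʳ-≤ R l<D) ⟩
    (3 + k0 + j) * k0 + R * (3 + k0 + j + e)            ≤⟨ m≤m+n _ (k0 * e) ⟩
    (3 + k0 + j) * k0 + R * (3 + k0 + j + e) + k0 * e   ≡⟨ identity k0 j e ⟩
    (3 + k0 + j) * (3 + k0 + j + e)                     ∎
    where
    open ≤-Reasoning
    regroup : ∀ b r l → b + r + r * l ≡ b + r * suc l
    regroup = solve-∀
    identity : ∀ k0 j e → (3 + k0 + j) * k0 + (3 + j) * (3 + k0 + j + e) + k0 * e ≡ (3 + k0 + j) * (3 + k0 + j + e)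
    identity = solve-∀

  tight-affords₁ : ∀ l → 1 + l ≤ 2 + k0 + j →
                   2 * ((3 + k0 + j) * k0 + R) + (R * l + R) ≤ 2 * ((3 + k0 + j) * (2 + k0 + j))
  tight-affords₁ l l<k1' = begin
    b + (R * l + R)                                      ≡⟨ cong (_+_ b) (regroup R l) ⟩
    b + R * suc l                                        ≤⟨ +-monoʳ-≤ b (*-monoʳ-≤ R l<k1') ⟩
    b + R * (2 + k0 + j)                                 ≤⟨ m≤m+n _ (suc j * k0 + j * j + 3 * j) ⟩
    b + R * (2 + k0 + j) + (suc j * k0 + j * j + 3 * j)  ≡⟨ identity k0 j ⟩
    2 * ((3 + k0 + j) * (2 + k0 + j))                    ∎
    where
    open ≤-Reasoning
    b = 2 * ((3 + k0 + j) * k0 + R)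
    regroup : ∀ r l → r * l + r ≡ r * suc l
    regroup = solve-∀
    identity : ∀ k0 j → 2 * ((3 + k0 + j) * k0 + (3 + j)) + (3 + j) * (2 + k0 + j) + (suc j * k0 + j * j + 3 * j)
                      ≡ 2 * ((3 + k0 + j) * (2 + k0 + j))
    identity = solve-∀

-- Since `R ≤ K`, the error per exceptional vertex is at most `K * suc k0`, so after division by
-- `2 * K` the constant no longer depends on `K`.
absorb-constant : ∀ {K N} R k0 e x → R ≤ K → N ≤ 2 * K * e + (K * k0 + R) * x →
                  N ≤ 2 * K * e + 2 * K * (suc k0 * x)
absorb-constant {K} R k0 e x R≤K N≤ = ≤-trans N≤ (+-monoʳ-≤ (2 * K * e) (begin
  (K * k0 + R) * x          ≤⟨ *-monoˡ-≤ x (+-monoʳ-≤ (K * k0) R≤K) ⟩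
  (K * k0 + K) * x          ≤⟨ m≤m+n _ _ ⟩
  (K * k0 + K) * x + K * (suc k0 * x)   ≡⟨ regroup K k0 x ⟩
  2 * K * (suc k0 * x)      ∎))
  where
  open ≤-Reasoning
  regroup : ∀ K k0 x → (K * k0 + K) * x + K * (suc k0 * x) ≡ 2 * K * (suc k0 * x)
  regroup = solve-∀

-- Assembly of the two bounds

theorem1p3 : ∀ {h} (H : Graph h) → TriangleFree H → HasEdge H → NoIsolatedEdge H →
    ∀ (k0 k1 k1' : ℕ) → IsK0 H k0 → IsK1 H k1 → IsK1' H k0 k1' → k0 + 2 ≤ k1' →
    Σ ℚ λ c →
    (∀ (n : ℕ) → h ≤ n → (G : Graph n) → Saturated G H →
    bound2 k0 k1' n c ℚ.≤ (+ edges G / 1)) ×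
    (k0 < k1 → ∀ (n : ℕ) → h ≤ n → (G : Graph n) → Saturated G H →
    bound1 k0 k1' n c ℚ.≤ (+ edges G / 1))
theorem1p3 H triangleFree _ _ k0 k1 k1' (_ , k0≤wt0) (_ , k1≤wt1) (_ , k1'≤wt1) gap
  with m≤n⇒∃[o]m+o≡n (≤-trans (≤-reflexive (+-comm 2 k0)) gap)
... | j , refl = + c / 1
    , (λ n _ G saturated →
        let open LowVertices {G = G} {H = H} saturated triangleFree k0≤wt0 k1'≤wt1 (m≤m+n (2 + k0) j)
            open Discharging (4 + k0 + j) R 0 (R≤ 1) (huge-affords₀ k0 j) (tight-affords₀ k0 j)
        in ≤⇒bound k0 R (3 + k0 + j) n (edges G) c numerator
             -- With `a = 0` there are no starved vertices, so their uniqueness is vacuous.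
             (absorb-constant R k0 (edges G) (exceptions k0) (R≤ 1) (global λ x _ (_ , ¬fed) _ → contradiction (lowDeg≤deg x) ¬fed)))
    , (λ k0<k1 n _ G saturated →
        let open LowVertices {G = G} {H = H} saturated triangleFree k0≤wt0 k1'≤wt1 (m≤m+n (2 + k0) j)
            open Discharging (3 + k0 + j) R 1 (R≤ 0) (huge-affords₁ k0 j) (tight-affords₁ k0 j)
        in ≤⇒bound k0 R (2 + k0 + j) n (edges G) c numerator
             (absorb-constant R k0 (edges G) (exceptions k0) (R≤ 0) (global (starved-unique λ u v uv → ≤-trans k0<k1 (k1≤wt1 u v uv)))))
  where
  R c : ℕ
  R = 3 + j
  c = suc k0 * exceptions k0
  R≤ : ∀ i → R ≤ i + (3 + k0 + j)
  R≤ i = ≤-trans (+-monoʳ-≤ 3 (m≤n+m j k0)) (m≤n+m _ i)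
  numerator : + (2 + k0 + j + 1) ℤ.- + k0 ≡ + R
  numerator = trans (cong (λ m → + m ℤ.- + k0) (shift k0 j)) (trans (cong (ℤ._- + k0) (ℤ.pos-+ R k0)) (cancel (+ R) (+ k0)))
    where
    shift : ∀ k0 j → 2 + k0 + j + 1 ≡ 3 + j + k0
    shift = solve-∀
    cancel : ∀ a b → a ℤ.+ b ℤ.- b ≡ a
    cancel = ℤ.solve-∀
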